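{- Let $q$ be a prime power and $n,m,k$ positive integers with $m<n\le km$. Let $t=\lfloor (km-n)/m\rfloor$, $a=n-(k-t-2)m$ and $h=\max\{\lfloor a/2^{t+1}\rfloor,1\}$. Then $L_{\mathrm{rk}}(n,m,k,q)\le m-h+1$.
   Context: $\mathbb{F}_{q^m}$ is the degree-$m$ extension of $\mathbb{F}_q$. Rank weight of $\mathbf v=(v_1,\dots,v_n)\in\mathbb{F}_{q^m}^n$: $\mathrm{w}(\mathbf v)=\dim_{\mathbb{F}_q}\langle v_1,\dots,v_n\rangle_{\mathbb{F}_q}$. An $[n,k]_{q^m/q}$ code is a $k$-dimensional $\mathbb{F}_{q^m}$-subspace $\mathcal C\subseteq\mathbb{F}_{q^m}^n$; it is nondegenerate if the $\mathbb{F}_q$-span of the columns of a generator matrix (a $k\times n$ matrix whose rows span $\mathcal C$) has $\mathbb{F}_q$-dimension $n$. $\mathrm{WS}(\mathcal C)=\{\mathrm{w}(\mathbf c):\mathbf c\in\mathcal C\setminus\{\mathbf 0\}\}$. $L_{\mathrm{rk}}(n,m,k,q)$ is the maximum of $|\mathrm{WS}(\mathcal C)|$ over all nondegenerate $[n,k]_{q^m/q}$ codes. -}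

module Defs where

open import Level using (0ℓ)
open import Data.Bool using (Bool; T)
open import Data.Nat using (ℕ; zero; suc; _∸_; _^_; _⊔_; NonZero)
import Data.Nat as N
open import Data.Nat.DivMod using (_/_)
open import Data.Nat.Properties using (m^n≢0)
open import Data.Nat.Primality using (Prime)
open import Data.Fin using (Fin; zero; suc)
open import Data.Product using (Σ; ∃; _×_; _,_)
open import Data.List using (List; length)
open import Data.List.Relation.Unary.All using (All)
open import Data.List.Relation.Unary.Unique.Propositional using (Unique)
open import Function.Bundles using (_↔_)
open import Relation.Binary.PropositionalEquality using (_≡_; _≢_)
open import Relation.Nullary using (¬_)
open import Algebra.Structures using (IsCommutativeRing)

IsPrimePower : ℕ → Set
IsPrimePower q = Σ ℕ λ p → Σ ℕ λ e → Prime p × (Σ ℕ λ e' → e ≡ suc e') × q ≡ p ^ e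

-- A finite field K = F_{q^m} (carrier of size q^m) together with the
-- subfield F = F_q (given by a Boolean membership predicate, of size q).
record FieldExt (q m : ℕ) : Set₁ where
  field
    K    : Set
    0# 1# : K
    _+_ _*_ : K → K → K
    -_   : K → K
    isCommutativeRing : IsCommutativeRing _≡_ _+_ _*_ -_ 0# 1#
    0≢1  : 0# ≢ 1#
    inverse : ∀ x → x ≢ 0# → Σ K λ y → x * y ≡ 1#
    inF  : K → Bool
    inF-0 : T (inF 0#)
    inF-1 : T (inF 1#)
    inF-+ : ∀ x y → T (inF x) → T (inF y) → T (inF (x + y))
    inF-* : ∀ x y → T (inF x) → T (inF y) → T (inF (x * y))
    inF-- : ∀ x → T (inF x) → T (inF (- x))
    inF-inv : ∀ x y → T (inF x) → x * y ≡ 1# → T (inF y)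
    card-F : Fin q ↔ Σ K (λ x → T (inF x))
    card-K : Fin (q ^ m) ↔ K

module RankMetric {q m : ℕ} (E : FieldExt q m) where
  open FieldExt E

  ∑ : (s : ℕ) → (Fin s → K) → K
  ∑ zero    f = 0#
  ∑ (suc s) f = f zero + ∑ s (λ i → f (suc i))

  Vec : ℕ → Set
  Vec r = Fin r → K

  _≈_ : ∀ {r} → Vec r → Vec r → Set
  u ≈ v = ∀ j → u j ≡ v j

  zeroV : ∀ {r} → Vec r
  zeroV _ = 0#

  lincomb : ∀ {s r} → (Fin s → K) → (Fin s → Vec r) → Vec r
  lincomb {s} c v j = ∑ s (λ i → c i * v i j)

  FScalars : ℕ → Set
  FScalars s = Σ (Fin s → K) λ c → ∀ i → T (inF (c i))

  FIndep : ∀ {s r} → (Fin s → Vec r) → Set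
  FIndep {s} v = ∀ (c : Fin s → K) → (∀ i → T (inF (c i))) →
                 lincomb c v ≈ zeroV → ∀ i → c i ≡ 0#

  InFSpan : ∀ {s r} → (Fin s → Vec r) → Vec r → Set
  InFSpan {s} v x = Σ (Fin s → K) λ c → (∀ i → T (inF (c i))) × (lincomb c v ≈ x)

  FDim : ∀ {s r} → (Fin s → Vec r) → ℕ → Set
  FDim {s} {r} v d = Σ (Fin d → Vec r) λ b →
    FIndep b × (∀ i → InFSpan v (b i)) × (∀ j → InFSpan b (v j))

  KIndep : ∀ {s r} → (Fin s → Vec r) → Set
  KIndep {s} v = ∀ (c : Fin s → K) → lincomb c v ≈ zeroV → ∀ i → c i ≡ 0#

  RankWeight : ∀ {n} → Vec n → ℕ → Set
  RankWeight {n} v w = FDim {n} {1} (λ i _ → v i) w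

  Matrix : ℕ → ℕ → Set
  Matrix k n = Fin k → Fin n → K

  IsGenerator : ∀ {k n} → Matrix k n → Set
  IsGenerator G = KIndep G

  codeword : ∀ {k n} → Matrix k n → Vec k → Vec n
  codeword G x = lincomb x G

  columns : ∀ {k n} → Matrix k n → Fin n → Vec k
  columns G j i = G i j

  Nondegenerate : ∀ {k n} → Matrix k n → Set
  Nondegenerate {k} {n} G = FDim (columns G) n

  -- w ∈ WS(C), where C is the row space of G
  InWS : ∀ {k n} → Matrix k n → ℕ → Set
  InWS G w = Σ (Vec _) λ x → ¬ (codeword G x ≈ zeroV) × RankWeight (codeword G x) w

  WSCardLE : ∀ {k n} → Matrix k n → ℕ → Set
  WSCardLE G b = ∀ (ws : List ℕ) → Unique ws → All (InWS G) ws → length ws N.≤ b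

tParam : (n m k : ℕ) → .{{NonZero m}} → ℕ
tParam n m k = (k N.* m ∸ n) / m

aParam : (n m k : ℕ) → .{{NonZero m}} → ℕ
aParam n m k = n ∸ (k ∸ tParam n m k ∸ 2) N.* m

hParam : (n m k : ℕ) → .{{NonZero m}} → ℕ
hParam n m k = (_/_ (aParam n m k) (2 ^ suc (tParam n m k)) {{m^n≢0 2 (suc (tParam n m k))}}) ⊔ 1

{-# OPTIONS --safe #-}
module Submission where

-- Scan the weights in increasing order, w₁ < w₂ < …, keeping a word of each weight that
-- is not in the K-span of the words kept so far.  If i words of total weight S are kept,
-- every word in their span has weight at most S, so the next kept weight exceeds S by at
-- most one more than the number of values skipped in between.  With u the number of values skipped
-- so far this gives 2(S + 1) ≤ 2^i (2 + u).  Once i = t + 2, counting the F-span of the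
-- columns of G forces S ≥ n − (k − t − 2)m = a, hence u ≥ h − 1; if the scan ends
-- earlier, the values between the last weight and m are skipped as well, and 2^t h ≤ m
-- gives the same conclusion.

open import Defs
open import Algebra.Bundles using (CommutativeRing; CommutativeSemiring)
open import Data.Bool using (T)
open import Data.Bool.Properties using (T-irrelevant)
open import Data.Empty using (⊥-elim)
open import Data.Fin using (Fin; zero; suc; combine; funToFin; finToFun)
open import Data.Fin.Properties using (combine-injective; funToFin-finToFin; finToFun-funToFin; injective⇒≤)
import Data.Fin.Properties as Finₚ
open import Data.List using (List; []; _∷_; _++_; length; map; tabulate)
open import Data.List.Properties using (length-tabulate; ++-identityʳ)
open import Data.List.Membership.Propositional using (_∈_)
open import Data.List.Membership.Propositional.Properties using (∈-++⁺ˡ; ∈-++⁺ʳ; ∈-++⁻)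
open import Data.List.Relation.Binary.Permutation.Propositional using (↭-sym; ↭⇒↭ₛ)
open import Data.List.Relation.Binary.Permutation.Propositional.Properties using (↭-length; All-resp-↭)
open import Data.List.Relation.Unary.All as All using (All; []; _∷_)
open import Data.List.Relation.Unary.AllPairs as AllPairs using (AllPairs; []; _∷_)
open import Data.List.Relation.Unary.Sorted.TotalOrder.Properties using (Sorted⇒AllPairs)
open import Data.List.Relation.Unary.Unique.Propositional using (Unique)
open import Data.List.Relation.Unary.Any using (here; there)
open import Data.Nat using (ℕ; zero; suc; _+_; _*_; _∸_; _^_; _⊔_; _≤_; _<_; z≤n; s≤s; s≤s⁻¹; NonZero; nonTrivial⇒n>1)
open import Data.Nat.DivMod using (_/_; m/n*n≤m)
open import Data.Nat.ListAction using (sum)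
open import Data.Nat.Primality using (prime⇒nonTrivial; prime⇒nonZero)
open import Data.Nat.Properties
open import Data.Nat.Tactic.RingSolver using (solve-∀)
open import Data.Product using (Σ; _×_; _,_; proj₁; proj₂)
open import Data.Sum using (_⊎_; inj₁; inj₂)
open import Function using (_∘_)
open import Function.Bundles using (Inverse)
open import Relation.Binary.PropositionalEquality using (_≡_; _≗_; refl; sym; trans; cong; cong₂; subst; setoid; module ≡-Reasoning)
open import Relation.Nullary using (¬_; Dec; yes; no)
open import Relation.Nullary.Decidable using (map′)

-- Semiring identities used in the vector computations.

module SemiringIdentities {c ℓ} (R : CommutativeSemiring c ℓ) where

  open CommutativeSemiring R renaming (_+_ to infixl 6 _⊕_; _*_ to infixl 7 _⊗_; refl to ≈-refl)
  open import Algebra.Solver.Ring.NaturalCoefficients.Default R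

  distrib-assoc : ∀ a x z u → (a ⊗ x ⊕ z) ⊗ u ≈ a ⊗ (x ⊗ u) ⊕ z ⊗ u
  distrib-assoc = solve 4 (λ a x z u → (a :* x :+ z) :* u := a :* (x :* u) :+ z :* u) ≈-refl

  exchange : ∀ x c g → x ⊗ (c ⊗ g) ≈ c ⊗ (x ⊗ g)
  exchange = solve 3 (λ x c g → x :* (c :* g) := c :* (x :* g)) ≈-refl

  collect : ∀ a b c x y z → a ⊗ (b ⊗ x ⊕ y) ⊕ (c ⊗ x ⊕ z) ≈ (a ⊗ b ⊕ c) ⊗ x ⊕ (a ⊗ y ⊕ z)
  collect = solve 6 (λ a b c x y z → a :* (b :* x :+ y) :+ (c :* x :+ z) :=
                                     (a :* b :+ c) :* x :+ (a :* y :+ z)) ≈-refl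

  distrib-comm : ∀ b a e z → b ⊗ (a ⊗ e ⊕ z) ≈ (a ⊗ b) ⊗ e ⊕ b ⊗ z
  distrib-comm = solve 4 (λ b a e z → b :* (a :* e :+ z) := (a :* b) :* e :+ b :* z) ≈-refl

-- Arithmetic of the scan: total weight against skipped values.

module WeightArithmetic where

  open ≤-Reasoning

  invariant-in-span : ∀ i u δ S → 2 * suc S ≤ 2 ^ i * (2 + u) → 2 * suc S ≤ 2 ^ i * (2 + (u + δ))
  invariant-in-span i u δ S inv = ≤-trans inv (*-monoʳ-≤ (2 ^ i) (+-monoʳ-≤ 2 (m≤m+n u δ)))

  -- Each newly skipped value raises the right side by `2 ^ suc i`, which is at least 2 because the
  -- exponent is positive.
  pow-absorbs : ∀ i u δ → 2 ^ suc i * (2 + u) + 2 * δ ≤ 2 ^ suc i * (2 + (u + δ))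
  pow-absorbs i u δ = begin
    2 ^ suc i * (2 + u) + 2 * δ            ≤⟨ +-monoʳ-≤ (2 ^ suc i * (2 + u)) (*-monoˡ-≤ δ (^-monoʳ-≤ 2 (s≤s (z≤n {i})))) ⟩
    2 ^ suc i * (2 + u) + 2 ^ suc i * δ    ≡⟨ *-distribˡ-+ (2 ^ suc i) (2 + u) δ ⟨
    2 ^ suc i * (2 + (u + δ))              ∎

  -- The new weight is `suc (j + u) + δ`, hence at most `S + 1 + δ`. Adding it to `S` at most
  -- doubles `S + 1`, up to `δ`; the doubling is paid for by the exponent and `δ` by the skipped
  -- values.
  invariant-off-span : ∀ i j u δ S → j + u ≤ S → 2 * suc S ≤ 2 ^ i * (2 + u) →
                       2 * suc (suc (j + u) + δ + S) ≤ 2 ^ suc i * (2 + (u + δ))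
  invariant-off-span i j u δ S last≤S inv = begin
    2 * suc (suc (j + u) + δ + S)          ≤⟨ *-monoʳ-≤ 2 (s≤s (+-monoˡ-≤ S (s≤s (+-monoˡ-≤ δ last≤S)))) ⟩
    2 * suc (suc S + δ + S)                ≡⟨ double S δ ⟩
    2 * (2 * suc S) + 2 * δ                ≤⟨ +-monoˡ-≤ (2 * δ) (*-monoʳ-≤ 2 inv) ⟩
    2 * (2 ^ i * (2 + u)) + 2 * δ          ≡⟨ cong (_+ 2 * δ) (*-assoc 2 (2 ^ i) (2 + u)) ⟨
    2 ^ suc i * (2 + u) + 2 * δ            ≤⟨ pow-absorbs i u δ ⟩
    2 ^ suc i * (2 + (u + δ))              ∎
    where
    double : ∀ S δ → 2 * suc (suc S + δ + S) ≡ 2 * (2 * suc S) + 2 * δ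
    double = solve-∀

  -- Halving the invariant gives `h * p ≤ S < p * (2 + v)`, and `p` cancels.
  gaps-from-sum : ∀ p h S v → h * p ≤ S → 2 * suc S ≤ 2 * p * (2 + v) → h ≤ suc v
  gaps-from-sum p h S v hp≤S inv = s≤s⁻¹ (*-cancelˡ-< p h (2 + v) (begin-strict
    p * h         ≡⟨ *-comm p h ⟩
    h * p         ≤⟨ hp≤S ⟩
    S             <⟨ *-cancelˡ-≤ 2 (≤-trans inv (≤-reflexive (*-assoc 2 p (2 + v)))) ⟩
    p * (2 + v)   ∎))

  -- The `δ` values between the last weight and `m` count as skipped. As the last weight is at most
  -- `S`, `m` is at most `S + δ`, so `m` can replace the total weight in `gaps-from-sum`.
  bound-at-end : ∀ {t i m j h} u S → i ≤ suc t → j + u ≤ S → j + u ≤ m → h * 2 ^ t ≤ m →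
                 2 * suc S ≤ 2 ^ i * (2 + u) → j + h ≤ suc m
  bound-at-end {t} {i} {m} {j} {h} u S i≤ last≤S last≤m h≤ inv with δ , refl ← m≤n⇒∃[o]m+o≡n last≤m = begin
    j + h              ≤⟨ +-monoʳ-≤ j (gaps-from-sum (2 ^ t) h (j + u + δ) (u + δ) h≤ inv′) ⟩
    j + suc (u + δ)    ≡⟨ rearrange j u δ ⟩
    suc (j + u + δ)    ∎
    where
    rearrange : ∀ j u δ → j + suc (u + δ) ≡ suc (j + u + δ)
    rearrange = solve-∀
    double : ∀ S δ → 2 * suc (S + δ) ≡ 2 * suc S + 2 * δ
    double = solve-∀
    inv′ : 2 * suc (j + u + δ) ≤ 2 ^ suc t * (2 + (u + δ))
    inv′ = begin
      2 * suc (j + u + δ)               ≤⟨ *-monoʳ-≤ 2 (s≤s (+-monoˡ-≤ δ last≤S)) ⟩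
      2 * suc (S + δ)                   ≡⟨ double S δ ⟩
      2 * suc S + 2 * δ                 ≤⟨ +-monoˡ-≤ (2 * δ) inv ⟩
      -- Raising the exponent to `suc t` also makes it positive, as `pow-absorbs` requires; `i`
      -- itself may be 0.
      2 ^ i * (2 + u) + 2 * δ           ≤⟨ +-monoˡ-≤ (2 * δ) (*-monoˡ-≤ (2 + u) (^-monoʳ-≤ 2 i≤)) ⟩
      2 ^ suc t * (2 + u) + 2 * δ       ≤⟨ pow-absorbs t u δ ⟩
      2 ^ suc t * (2 + (u + δ))         ∎

  ascending-length : ∀ {m} l ws → l ≤ m → All (l <_) ws → AllPairs _<_ ws → All (_≤ m) ws → l + length ws ≤ m
  ascending-length l []       l≤m _          _                _            = ≤-trans (≤-reflexive (+-identityʳ l)) l≤m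
  ascending-length l (w ∷ ws) l≤m (l<w ∷ _)  (w<ws ∷ ws<)     (w≤m ∷ ws≤m) = begin
    l + suc (length ws)   ≡⟨ +-suc l (length ws) ⟩
    suc l + length ws     ≤⟨ +-monoˡ-≤ (length ws) l<w ⟩
    w + length ws         ≤⟨ ascending-length w ws w≤m w<ws ws< ws≤m ⟩
    _                     ∎

  bound-from-gaps : ∀ {m} j u h l → h ≤ suc u → j + u + l ≤ m → j + l + h ≤ suc m
  bound-from-gaps {m} j u h l h≤ le = begin
    j + l + h        ≤⟨ +-monoʳ-≤ (j + l) h≤ ⟩
    j + l + suc u    ≡⟨ rearrange j l u ⟩
    suc (j + u + l)  ≤⟨ s≤s le ⟩
    suc m            ∎
    where
    rearrange : ∀ j l u → j + l + suc u ≡ suc (j + u + l)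
    rearrange = solve-∀

-- Sums and dot products over the field.

module LinearAlgebra {q m : ℕ} (E : FieldExt q m) where
  open FieldExt E using (K; 0#; 1#; isCommutativeRing; inverse; inF; inF-0; inF-+; inF-*; inF--; card-F; card-K) renaming (_+_ to infixl 6 _⊕_; _*_ to infixl 7 _⊗_; -_ to infix 8 ⊖_)
  open RankMetric E

  ring : CommutativeRing _ _
  ring = record { isCommutativeRing = isCommutativeRing }

  private
    module R = CommutativeRing ring
    open import Algebra.Properties.Semiring.Sum R.semiring as S using ()
    open import Algebra.Properties.Ring R.ring using (-‿distribˡ-*)
    open import Algebra.Properties.Group R.+-group using (x∙y⁻¹≈ε⇒x≈y; identityˡ-unique)
    open SemiringIdentities R.commutativeSemiring

  ∑≡sum : ∀ s (f : Fin s → K) → ∑ s f ≡ S.sum f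
  ∑≡sum zero    f = refl
  ∑≡sum (suc s) f = cong (f zero ⊕_) (∑≡sum s (f ∘ suc))

  ∑-cong : ∀ s {f g : Fin s → K} → f ≗ g → ∑ s f ≡ ∑ s g
  ∑-cong zero    f≗g = refl
  ∑-cong (suc s) f≗g = cong₂ _⊕_ (f≗g zero) (∑-cong s (f≗g ∘ suc))

  ∑-zero : ∀ s → ∑ s (λ _ → 0#) ≡ 0#
  ∑-zero zero    = refl
  ∑-zero (suc s) = trans (R.+-identityˡ _) (∑-zero s)

  ∑-⊕ : ∀ s (f g : Fin s → K) → ∑ s (λ i → f i ⊕ g i) ≡ ∑ s f ⊕ ∑ s g
  ∑-⊕ s f g = begin
    ∑ s (λ i → f i ⊕ g i)     ≡⟨ ∑≡sum s _ ⟩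
    S.sum (λ i → f i ⊕ g i)   ≡⟨ S.∑-distrib-+ f g ⟩
    S.sum f ⊕ S.sum g         ≡⟨ cong₂ _⊕_ (∑≡sum s f) (∑≡sum s g) ⟨
    ∑ s f ⊕ ∑ s g             ∎
    where open ≡-Reasoning

  ∑-⊗ : ∀ s a (f : Fin s → K) → a ⊗ ∑ s f ≡ ∑ s (λ i → a ⊗ f i)
  ∑-⊗ s a f = begin
    a ⊗ ∑ s f                 ≡⟨ cong (a ⊗_) (∑≡sum s f) ⟩
    a ⊗ S.sum f               ≡⟨ S.*-distribˡ-sum a f ⟩
    S.sum (λ i → a ⊗ f i)     ≡⟨ ∑≡sum s _ ⟨
    ∑ s (λ i → a ⊗ f i)       ∎
    where open ≡-Reasoning

  ∑-swap : ∀ r s (f : Fin r → Fin s → K) →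
           ∑ r (λ i → ∑ s (f i)) ≡ ∑ s (λ j → ∑ r (λ i → f i j))
  ∑-swap r s f = begin
    ∑ r (λ i → ∑ s (f i))               ≡⟨ ∑-cong r (λ i → ∑≡sum s (f i)) ⟩
    ∑ r (λ i → S.sum (f i))             ≡⟨ ∑≡sum r _ ⟩
    S.sum (λ i → S.sum (f i))           ≡⟨ S.∑-comm f ⟩
    S.sum (λ j → S.sum (λ i → f i j))   ≡⟨ ∑≡sum s _ ⟨
    ∑ s (λ j → S.sum (λ i → f i j))     ≡⟨ ∑-cong s (λ j → ∑≡sum r (λ i → f i j)) ⟨
    ∑ s (λ j → ∑ r (λ i → f i j))       ∎
    where open ≡-Reasoning

  unit : ∀ {s} → Fin s → Vec s
  unit zero    zero    = 1#
  unit zero    (suc j) = 0#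
  unit (suc i) zero    = 0#
  unit (suc i) (suc j) = unit i j

  unit-sym : ∀ {s} (i j : Fin s) → unit i j ≡ unit j i
  unit-sym zero    zero    = refl
  unit-sym zero    (suc j) = refl
  unit-sym (suc i) zero    = refl
  unit-sym (suc i) (suc j) = unit-sym i j

  dot : ∀ {k} → Vec k → Vec k → K
  dot {k} x u = ∑ k (λ i → x i ⊗ u i)

  dot-zeroˡ : ∀ {k} {x : Vec k} u → x ≈ zeroV → dot x u ≡ 0#
  dot-zeroˡ {k} u x≈0 =
    trans (∑-cong k (λ i → trans (cong (_⊗ u i) (x≈0 i)) (R.zeroˡ _))) (∑-zero k)

  dot-unit : ∀ {k} (i : Fin k) u → dot (unit i) u ≡ u i
  dot-unit zero    u = trans (cong₂ _⊕_ (R.*-identityˡ _) (dot-zeroˡ (u ∘ suc) (λ _ → refl))) (R.+-identityʳ _)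
  dot-unit (suc i) u = trans (cong₂ _⊕_ (R.zeroˡ _) (dot-unit i (u ∘ suc))) (R.+-identityˡ _)

  _+⟨_⟩_ : ∀ {k} → Vec k → K → Vec k → Vec k
  (z +⟨ a ⟩ x) j = a ⊗ x j ⊕ z j

  dot-linearˡ : ∀ {k} {y : Vec k} a x z u → y ≈ (z +⟨ a ⟩ x) → dot y u ≡ a ⊗ dot x u ⊕ dot z u
  dot-linearˡ {k} {y} a x z u y≈ = begin
    ∑ k (λ i → y i ⊗ u i)                                    ≡⟨ ∑-cong k (λ i → trans (cong (_⊗ u i) (y≈ i)) (distrib-assoc a (x i) (z i) (u i))) ⟩
    ∑ k (λ i → a ⊗ (x i ⊗ u i) ⊕ z i ⊗ u i)                  ≡⟨ ∑-⊕ k _ _ ⟩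
    ∑ k (λ i → a ⊗ (x i ⊗ u i)) ⊕ ∑ k (λ i → z i ⊗ u i)      ≡⟨ cong (_⊕ dot z u) (∑-⊗ k a _) ⟨
    a ⊗ dot x u ⊕ dot z u                                    ∎
    where open ≡-Reasoning

  -- The bridge between columns and codewords: the functional `dot x` sends the column `j` to the
  -- entry `j` of the codeword of `x`, so it carries the F-span of the columns into the F-span of
  -- the entries.
  dot-columns : ∀ {k n} (G : Matrix k n) x (c : Fin n → K) {u} → lincomb c (columns G) ≈ u →
                dot x u ≡ ∑ n (λ j → c j ⊗ codeword G x j)
  dot-columns {k} {n} G x c {u} c≈u = begin
    ∑ k (λ i → x i ⊗ u i)                                ≡⟨ ∑-cong k (λ i → cong (x i ⊗_) (sym (c≈u i))) ⟩
    ∑ k (λ i → x i ⊗ ∑ n (λ j → c j ⊗ G i j))            ≡⟨ ∑-cong k (λ i → ∑-⊗ n (x i) _) ⟩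
    ∑ k (λ i → ∑ n (λ j → x i ⊗ (c j ⊗ G i j)))          ≡⟨ ∑-swap k n _ ⟩
    ∑ n (λ j → ∑ k (λ i → x i ⊗ (c j ⊗ G i j)))          ≡⟨ ∑-cong n (λ j → ∑-cong k (λ i → exchange (x i) (c j) (G i j))) ⟩
    ∑ n (λ j → ∑ k (λ i → c j ⊗ (x i ⊗ G i j)))          ≡⟨ ∑-cong n (λ j → ∑-⊗ k (c j) _) ⟨
    ∑ n (λ j → c j ⊗ codeword G x j)                     ∎
    where open ≡-Reasoning

  -- K-spans

  _≟K_ : (x y : K) → Dec (x ≡ y)
  x ≟K y = map′ (λ eq → trans (sym (K.strictlyInverseˡ x)) (trans (cong K.to eq) (K.strictlyInverseˡ y)))
                (cong K.from) (K.from x Finₚ.≟ K.from y)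
    where module K = Inverse card-K

  KSpan : ∀ {k} → List (Vec k) → Vec k → Set
  KSpan []       y = y ≈ zeroV
  KSpan (x ∷ xs) y = Σ K λ a → Σ (Vec _) λ z → KSpan xs z × (y ≈ (z +⟨ a ⟩ x))

  KSpan-resp : ∀ {k} (xs : List (Vec k)) {y y′} → y ≈ y′ → KSpan xs y → KSpan xs y′
  KSpan-resp []       y≈y′ y≈0              = λ j → trans (sym (y≈y′ j)) (y≈0 j)
  KSpan-resp (x ∷ xs) y≈y′ (a , z , z∈ , y≈) = a , z , z∈ , λ j → trans (sym (y≈y′ j)) (y≈ j)

  KSpan-zero : ∀ {k} (xs : List (Vec k)) → KSpan xs zeroV
  KSpan-zero []       = λ _ → refl
  KSpan-zero (x ∷ xs) = 0# , zeroV , KSpan-zero xs , λ j → sym (trans (R.+-identityʳ _) (R.zeroˡ _))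

  KSpan-linear : ∀ {k} (xs : List (Vec k)) a {y z} → KSpan xs y → KSpan xs z → KSpan xs (z +⟨ a ⟩ y)
  KSpan-linear []       a {y} {z} y≈0 z≈0 j =
    trans (cong₂ (λ s t → a ⊗ s ⊕ t) (y≈0 j) (z≈0 j)) (trans (R.+-identityʳ _) (R.zeroʳ a))
  KSpan-linear (x ∷ xs) a (b , y′ , y′∈ , y≈) (c , z′ , z′∈ , z≈) =
    a ⊗ b ⊕ c , (z′ +⟨ a ⟩ y′) , KSpan-linear xs a y′∈ z′∈ ,
    λ j → trans (cong₂ (λ s t → a ⊗ s ⊕ t) (y≈ j) (z≈ j)) (collect a b c (x j) (y′ j) (z′ j))

  ∈⇒KSpan : ∀ {k} {xs : List (Vec k)} {x} → x ∈ xs → KSpan xs x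
  ∈⇒KSpan {xs = x ∷ xs} (here refl) =
    1# , zeroV , KSpan-zero xs , λ j → sym (trans (R.+-identityʳ _) (R.*-identityˡ _))
  ∈⇒KSpan {xs = x ∷ xs} {y} (there y∈) =
    0# , y , ∈⇒KSpan y∈ , λ j → sym (trans (cong (_⊕ y j) (R.zeroˡ _)) (R.+-identityˡ _))

  KSpan-mono : ∀ {k} (xs ys : List (Vec k)) → (∀ {x} → x ∈ xs → KSpan ys x) →
               ∀ {y} → KSpan xs y → KSpan ys y
  KSpan-mono []       ys xs⊆ y≈0 = KSpan-resp ys (λ j → sym (y≈0 j)) (KSpan-zero ys)
  KSpan-mono (x ∷ xs) ys xs⊆ (a , z , z∈ , y≈) =
    KSpan-resp ys (λ j → sym (y≈ j)) (KSpan-linear ys a (xs⊆ (here refl)) (KSpan-mono xs ys (xs⊆ ∘ there) z∈))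

  lincomb∈KSpan : ∀ {s k} c (v : Fin s → Vec k) → KSpan (tabulate v) (lincomb c v)
  lincomb∈KSpan {zero}  c v = λ _ → refl
  lincomb∈KSpan {suc s} c v = c zero , _ , lincomb∈KSpan (c ∘ suc) (v ∘ suc) , λ _ → refl

  KSpan-units : ∀ {k} (y : Vec k) → KSpan (tabulate unit) y
  KSpan-units {k} y = KSpan-resp (tabulate unit) y-expansion (lincomb∈KSpan y unit)
    where
    y-expansion : lincomb y unit ≈ y
    y-expansion j = trans (∑-cong k (λ i → trans (R.*-comm _ _) (cong (_⊗ y i) (unit-sym i j)))) (dot-unit j y)

  -- Expand `y` over `es ++ xs`. If no coefficient on `es` survives, `y` lies in the span of `xs`;
  -- otherwise the first `e` with a nonzero coefficient is expressed through `y` and the rest, and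
  -- `y` takes its place.
  steinitz-exchange : ∀ {k} (es xs : List (Vec k)) y → KSpan (es ++ xs) y →
    KSpan xs y ⊎ Σ (List (Vec k)) λ es′ → (length es ≡ suc (length es′)) ×
                   (∀ {z} → KSpan (es ++ xs) z → KSpan (es′ ++ y ∷ xs) z)
  steinitz-exchange []       xs y y∈ = inj₁ y∈
  steinitz-exchange (e ∷ es) xs y (a , z , z∈ , y≈) with a ≟K 0#
  -- With coefficient 0 the remainder `z` equals `y` pointwise, so the search continues in `es`.
  ... | yes refl with steinitz-exchange es xs y (KSpan-resp (es ++ xs) (λ j → sym (trans (y≈ j) (trans (cong (_⊕ z j) (R.zeroˡ _)) (R.+-identityˡ _)))) z∈)
  ...   | inj₁ y∈xs             = inj₁ y∈xs
  ...   | inj₂ (es′ , len , es⊆) = inj₂ (e ∷ es′ , cong suc len , λ (b , z′ , z′∈ , eq) → b , z′ , es⊆ z′∈ , eq)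
  steinitz-exchange (e ∷ es) xs y (a , z , z∈ , y≈) | no a≢0 = inj₂ (es , refl , KSpan-mono (e ∷ es ++ xs) new old⊆new)
    where
    new = es ++ y ∷ xs
    a⁻¹ = proj₁ (inverse a a≢0)

    tail⊆new : ∀ {x} → x ∈ es ++ xs → KSpan new x
    tail⊆new x∈ with ∈-++⁻ es x∈
    ... | inj₁ x∈es = ∈⇒KSpan (∈-++⁺ˡ x∈es)
    ... | inj₂ x∈xs = ∈⇒KSpan (∈-++⁺ʳ es (there x∈xs))

    solve-e : ∀ b a e z → b ⊗ (a ⊗ e ⊕ z) ⊕ (⊖ b ⊗ z ⊕ 0#) ≡ (a ⊗ b) ⊗ e
    solve-e b a e z = trans (cong₂ _⊕_ (distrib-comm b a e z) (trans (R.+-identityʳ _) (sym (-‿distribˡ-* b z)))) (trans (R.+-assoc _ _ _) (trans (cong (_ ⊕_) (R.-‿inverseʳ _)) (R.+-identityʳ _)))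

    -- From `y = a e + z` follows `e = a⁻¹ y - a⁻¹ z`. The extra `0#` comes from writing `- a⁻¹ z`
    -- as `zeroV +⟨ ⊖ a⁻¹ ⟩ z`.
    e∈new : KSpan new e
    e∈new = KSpan-resp new
      (λ j → trans (cong (λ t → a⁻¹ ⊗ t ⊕ (⊖ a⁻¹ ⊗ z j ⊕ 0#)) (y≈ j))
             (trans (solve-e a⁻¹ a (e j) (z j))
             (trans (cong (_⊗ e j) (proj₂ (inverse a a≢0))) (R.*-identityˡ _))))
      (KSpan-linear new a⁻¹ {y} {zeroV +⟨ ⊖ a⁻¹ ⟩ z} (∈⇒KSpan (∈-++⁺ʳ es (here refl)))
        (KSpan-linear new (⊖ a⁻¹) (KSpan-mono (es ++ xs) new tail⊆new z∈) (KSpan-zero new)))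

    old⊆new : ∀ {x} → x ∈ e ∷ es ++ xs → KSpan new x
    old⊆new (here refl) = e∈new
    old⊆new (there x∈)  = tail⊆new x∈

  -- F-spans

  FSpan-resp : ∀ {s r} (v : Fin s → Vec r) {x y} → x ≈ y → InFSpan v x → InFSpan v y
  FSpan-resp v x≈y (c , cF , eq) = c , cF , λ j → trans (eq j) (x≈y j)

  FSpan-linear : ∀ {s r} (v : Fin s → Vec r) a → T (inF a) → ∀ {x z} →
                 InFSpan v x → InFSpan v z → InFSpan v (z +⟨ a ⟩ x)
  FSpan-linear {s} v a aF (c , cF , c≈x) (d , dF , d≈z) =
    (λ i → a ⊗ c i ⊕ d i) , (λ i → inF-+ _ _ (inF-* _ _ aF (cF i)) (dF i)) ,
    λ j → trans (dot-linearˡ a c d (λ i → v i j) (λ _ → refl)) (cong₂ (λ s t → a ⊗ s ⊕ t) (c≈x j) (d≈z j))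

  FSpan-lincomb : ∀ {s t r} (v : Fin s → Vec r) (b : Fin t → Vec r) c → (∀ i → T (inF (c i))) →
                  (∀ i → InFSpan v (b i)) → InFSpan v (lincomb c b)
  FSpan-lincomb {t = zero}  v b c cF b∈ = (λ _ → 0#) , (λ _ → inF-0) , λ j → dot-zeroˡ (λ i → v i j) (λ _ → refl)
  FSpan-lincomb {t = suc t} v b c cF b∈ =
    FSpan-linear v (c zero) (cF zero) (b∈ zero) (FSpan-lincomb v (b ∘ suc) (c ∘ suc) (cF ∘ suc) (b∈ ∘ suc))

  FIndep-injective : ∀ {s r} {b : Fin s → Vec r} → FIndep b → ∀ {c d} →
    (∀ i → T (inF (c i))) → (∀ i → T (inF (d i))) → lincomb c b ≈ lincomb d b → c ≗ d
  FIndep-injective {b = b} indep {c} {d} cF dF eq i =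
    x∙y⁻¹≈ε⇒x≈y _ _ (indep (λ i → c i ⊕ ⊖ d i) (λ i → inF-+ _ _ (cF i) (inF-- _ (dF i))) difference≈0 i)
    where
    -- Writing `c` as `1 (c - d) + d` puts it in the shape of `dot-linearˡ`, so independence can be
    -- applied to the difference.
    move : ∀ c d → c ≡ 1# ⊗ (c ⊕ ⊖ d) ⊕ d
    move c d = sym (trans (cong (_⊕ d) (R.*-identityˡ _)) (trans (R.+-assoc _ _ _) (trans (cong (c ⊕_) (R.-‿inverseˡ d)) (R.+-identityʳ c))))
    difference≈0 : lincomb (λ i → c i ⊕ ⊖ d i) b ≈ zeroV
    difference≈0 j = identityˡ-unique _ _ (trans (cong (_⊕ lincomb d b j) (sym (R.*-identityˡ _)))
      (trans (sym (dot-linearˡ 1# (λ i → c i ⊕ ⊖ d i) d (λ i → b i j) (λ i → move (c i) (d i)))) (eq j)))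

  -- Counting

  private
    module F  = Inverse card-F
    module K# = Inverse card-K

  -- An enumeration of all coefficient vectors in F^s: the base-`q` digits of the index, read in F
  -- through `card-F`.
  scalars : ∀ s → Fin (q ^ s) → Fin s → K
  scalars s c i = proj₁ (F.to (finToFun {q} {s} c i))

  scalars-inF : ∀ s c i → T (inF (scalars s c i))
  scalars-inF s c i = proj₂ (F.to (finToFun {q} {s} c i))

  F-≡ : {x y : Σ K (λ x → T (inF x))} → proj₁ x ≡ proj₁ y → x ≡ y
  F-≡ {x , _} refl = cong (x ,_) (T-irrelevant _ _)

  funToFin-cong : ∀ {a b} {f g : Fin a → Fin b} → f ≗ g → funToFin f ≡ funToFin g
  funToFin-cong {zero}  f≗g = refl
  funToFin-cong {suc a} f≗g = cong₂ combine (f≗g zero) (funToFin-cong (f≗g ∘ suc))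

  scalars-injective : ∀ s {c d} → scalars s c ≗ scalars s d → c ≡ d
  scalars-injective s {c} {d} eq = begin
    c                                   ≡⟨ funToFin-finToFin {s} c ⟨
    funToFin (finToFun {q} {s} c)       ≡⟨ funToFin-cong (λ i → trans (sym (F.strictlyInverseʳ _)) (trans (cong F.from (F-≡ (eq i))) (F.strictlyInverseʳ _))) ⟩
    funToFin (finToFun {q} {s} d)       ≡⟨ funToFin-finToFin {s} d ⟩
    d                                   ∎
    where open ≡-Reasoning

  -- A certificate that `φ` takes at most `N` values, given by labels rather than by forming the
  -- image.
  Determined : {C : Set} → (C → K) → ℕ → Set
  Determined {C} φ N = Σ (C → Fin N) λ f → ∀ c d → f c ≡ f d → φ c ≡ φ d

  K-determined : ∀ {C} (φ : C → K) → Determined φ (q ^ m)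
  K-determined φ = K#.from ∘ φ ,
    λ c d eq → trans (sym (K#.strictlyInverseˡ _)) (trans (cong K#.to eq) (K#.strictlyInverseˡ _))

  FSpan-determined : ∀ {C w} (b : Fin w → Vec 1) (φ : C → K) → (∀ c → InFSpan b (λ _ → φ c)) →
                     Determined φ (q ^ w)
  FSpan-determined {C} {w} b φ φ∈ = funToFin ∘ digits , λ c d eq →
    trans (sym (proj₂ (proj₂ (φ∈ c)) zero))
    (trans (∑-cong w (λ i → cong (_⊗ b i zero) (coeff-≡ c d eq i))) (proj₂ (proj₂ (φ∈ d)) zero))
    where
    digits : C → Fin w → Fin q
    digits c i = F.from (proj₁ (φ∈ c) i , proj₁ (proj₂ (φ∈ c)) i)
    digits-≡ : ∀ c d → funToFin (digits c) ≡ funToFin (digits d) → digits c ≗ digits d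
    digits-≡ c d eq i = trans (sym (finToFun-funToFin _ i)) (trans (cong (λ t → finToFun t i) eq) (finToFun-funToFin _ i))
    coeff-≡ : ∀ c d → funToFin (digits c) ≡ funToFin (digits d) → proj₁ (φ∈ c) ≗ proj₁ (φ∈ d)
    coeff-≡ c d eq i = cong proj₁ (trans (sym (F.strictlyInverseˡ _)) (trans (cong F.to (digits-≡ c d eq i)) (F.strictlyInverseˡ _)))

  -- Each `u c` is viewed as a functional on the K-span of `xs`; one label serves all `y` at once,
  -- so at most `N` such restrictions occur.
  KSpan-Determined : ∀ {C k} → (C → Vec k) → List (Vec k) → ℕ → Set
  KSpan-Determined {C} u xs N =
    Σ (C → Fin N) λ f → ∀ c d → f c ≡ f d → ∀ {y} → KSpan xs y → dot y (u c) ≡ dot y (u d)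

  []-determined : ∀ {C k} (u : C → Vec k) → KSpan-Determined u [] 1
  []-determined u = (λ _ → zero) , λ c d _ y≈0 → trans (dot-zeroˡ (u c) y≈0) (sym (dot-zeroˡ (u d) y≈0))

  -- For `y = a x + z` the value is `a` times that of `x` plus that of `z`, so the pair of labels
  -- suffices and the exponents add.
  ∷-determined : ∀ {C k} {u : C → Vec k} {x xs} M N → Determined (dot x ∘ u) (q ^ M) →
    KSpan-Determined u xs (q ^ N) → KSpan-Determined u (x ∷ xs) (q ^ (M + N))
  ∷-determined {C} {u = u} {x} {xs} M N (f , f-det) (g , g-det) =
    subst (KSpan-Determined u (x ∷ xs)) (sym (^-distribˡ-+-* q M N)) (fg , fg-det)
    where
    fg : C → Fin (q ^ M * q ^ N)
    fg c = combine (f c) (g c)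
    fg-det : ∀ c d → fg c ≡ fg d → ∀ {y} → KSpan (x ∷ xs) y → dot y (u c) ≡ dot y (u d)
    fg-det c d eq (a , z , z∈ , y≈) with f≡ , g≡ ← combine-injective (f c) (g c) (f d) (g d) eq =
      trans (dot-linearˡ a x z (u c) y≈)
      (trans (cong₂ (λ s t → a ⊗ s ⊕ t) (f-det c d f≡) (g-det c d g≡ z∈)) (sym (dot-linearˡ a x z (u d) y≈)))

  -- A vector about which nothing is known costs `m` digits, since its dot products lie in K, which
  -- has `q ^ m` elements.
  ++-determined : ∀ {C k} {u : C → Vec k} {xs} N es → KSpan-Determined u xs (q ^ N) →
                  KSpan-Determined u (es ++ xs) (q ^ (length es * m + N))
  ++-determined N []       det = det
  ++-determined {u = u} {xs} N (e ∷ es) det =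
    subst (λ s → KSpan-Determined u (e ∷ es ++ xs) (q ^ s)) (sym (+-assoc m (length es * m) N))
      (∷-determined m (length es * m + N) (K-determined _) (++-determined N es det))

  -- Dimension bounds by counting.

  module _ (1<q : 1 < q) where

    injective⇒exponent-≤ : ∀ a b (f : Fin (q ^ a) → Fin (q ^ b)) → (∀ c d → f c ≡ f d → c ≡ d) → a ≤ b
    injective⇒exponent-≤ a b f inj =
      ≮⇒≥ λ b<a → <⇒≱ (^-monoʳ-< q 1<q b<a) (injective⇒≤ {f = f} (λ {c} {d} → inj c d))

    -- Independence makes all `q ^ s` combinations distinct, so labels that determine them are
    -- injective into `Fin (q ^ N)`.
    FIndep-≤ : ∀ {s r N} {b : Fin s → Vec r} → FIndep b → (f : Fin (q ^ s) → Fin (q ^ N)) →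
      (∀ c d → f c ≡ f d → lincomb (scalars s c) b ≈ lincomb (scalars s d) b) → s ≤ N
    FIndep-≤ {s} {N = N} indep f f-det = injective⇒exponent-≤ s N f λ c d eq →
      scalars-injective s (FIndep-injective indep (scalars-inF s c) (scalars-inF s d) (f-det c d eq))

    rankWeight-≤ : ∀ {n} {v : Vec n} {w} → RankWeight v w → w ≤ m
    rankWeight-≤ {w = w} (b , indep , _ , _) with K-determined {Fin (q ^ w)} (λ c → lincomb (scalars w c) b zero)
    ... | f , f-det = FIndep-≤ indep f λ { c d eq zero → f-det c d eq }

    rankWeight->0 : ∀ {n} {v : Vec n} {w} → RankWeight v w → ¬ (v ≈ zeroV) → 0 < w
    rankWeight->0 {w = zero}  (_ , _ , _ , v∈) v≉0 = ⊥-elim (v≉0 λ j → sym (proj₂ (proj₂ (v∈ j)) zero))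
    rankWeight->0 {w = suc w} _                _   = s≤s z≤n

    -- Words of the code and their weights.

    module _ {k n} (G : Matrix k n) where

      record Word : Set where
        constructor word
        field
          message : Vec k
          weight  : ℕ
          rank    : RankWeight (codeword G message) weight
      open Word public

      totalWeight : List Word → ℕ
      totalWeight xs = sum (map weight xs)

      -- On the F-span of the columns, `dot x` takes values in the F-span of the entries of the
      -- codeword of `x`, so a word of weight `w` costs only `w` digits instead of `m`.
      words-determined : ∀ {C} {u : C → Vec k} → (∀ c → InFSpan (columns G) (u c)) →
        (xs : List Word) → KSpan-Determined u (map message xs) (q ^ totalWeight xs)
      words-determined {u = u} u∈ []       = []-determined u
      words-determined {u = u} u∈ (word x w (b , _ , _ , xG∈) ∷ xs) =
        ∷-determined w (totalWeight xs) (FSpan-determined b _ dot∈) (words-determined u∈ xs)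
        where
        dot∈ : ∀ c → InFSpan b (λ _ → dot x (u c))
        dot∈ c with γ , γF , γ≈u ← u∈ c =
          FSpan-resp b (λ _ → sym (dot-columns G x γ γ≈u)) (FSpan-lincomb b (λ j _ → codeword G x j) γ γF xG∈)

      -- The `q ^ w` elements of the F-span of the entries of the word `y` are values `dot y (u c)`
      -- with `u c` in the F-span of the columns. As `y` is in the K-span of the messages,
      -- `totalWeight xs` digits determine them.
      weight-≤-totalWeight : ∀ xs (y : Word) → KSpan (map message xs) (message y) → weight y ≤ totalWeight xs
      weight-≤-totalWeight xs (word y w (b , indep , b∈ , _)) y∈ =
        FIndep-≤ indep (proj₁ det) λ { c d eq zero → trans (sym (dot-u c)) (trans (proj₂ det c d eq y∈) (dot-u d)) }
        where
        γ : (c : Fin (q ^ w)) → InFSpan (λ j _ → codeword G y j) (lincomb (scalars w c) b)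
        γ c = FSpan-lincomb _ b (scalars w c) (scalars-inF w c) b∈
        u : Fin (q ^ w) → Vec k
        u c = lincomb (proj₁ (γ c)) (columns G)
        dot-u : ∀ c → dot y (u c) ≡ lincomb (scalars w c) b zero
        dot-u c = trans (dot-columns G y (proj₁ (γ c)) (λ _ → refl)) (proj₂ (proj₂ (γ c)) zero)
        det : KSpan-Determined u (map message xs) (q ^ totalWeight xs)
        det = words-determined (λ c → proj₁ (γ c) , proj₁ (proj₂ (γ c)) , λ _ → refl) xs

      -- The F-span of the columns has `q ^ n` elements. Each is determined by its dot products with
      -- a spanning list, at a cost of `m` digits per vector of `es` and the weight for each word of
      -- `xs`.
      nondegenerate-≤ : Nondegenerate G → ∀ es xs → (∀ y → KSpan (es ++ map message xs) y) →
                        n ≤ length es * m + totalWeight xs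
      nondegenerate-≤ (b , indep , b∈ , _) es xs spanning =
        FIndep-≤ indep (proj₁ det) λ c d eq i →
          -- Spanning is applied to the unit vectors, which read off the coordinates.
          trans (sym (dot-unit i _)) (trans (proj₂ det c d eq (spanning (unit i))) (dot-unit i _))
        where
        u : Fin (q ^ n) → Vec k
        u c = lincomb (scalars n c) b
        det : KSpan-Determined u (es ++ map message xs) (q ^ (length es * m + totalWeight xs))
        det = ++-determined (totalWeight xs) es (words-determined (λ c → FSpan-lincomb _ b (scalars n c) (scalars-inF n c) b∈) xs)

      InWS-≤ : ∀ {w} → InWS G w → w ≤ m
      InWS-≤ (_ , _ , r) = rankWeight-≤ r

      InWS->0 : ∀ {w} → InWS G w → 0 < w
      InWS->0 (_ , x≉0 , r) = rankWeight->0 r x≉0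

      open WeightArithmetic

      -- The scan through the ascending weights.

      module _ (t h : ℕ) (h≤m : h * 2 ^ t ≤ m)
        (large : ∀ es xs → (∀ y → KSpan (es ++ map message xs) y) →
                 length es + length xs ≡ k → length xs ≡ 2 + t → h * 2 ^ suc t ≤ totalWeight xs) where

        -- The scan has processed j weights, the last being j + u, so u counts the
        -- positive integers up to it that are not among the weights.
        scan : ∀ j u es xs → (∀ y → KSpan (es ++ map message xs) y) →
          length es + length xs ≡ k → length xs ≤ suc t →
          j + u ≤ m → j + u ≤ totalWeight xs →
          2 * suc (totalWeight xs) ≤ 2 ^ length xs * (2 + u) →
          ∀ ws → All (j + u <_) ws → AllPairs _<_ ws → All (InWS G) ws → j + length ws + h ≤ suc m
        scan j u es xs spanning len i≤ last≤m last≤S inv [] _ _ _ =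
          subst (λ j′ → j′ + h ≤ suc m) (sym (+-identityʳ j)) (bound-at-end u (totalWeight xs) i≤ last≤S last≤m h≤m inv)
        scan j u es xs spanning len i≤ last≤m last≤S inv (w ∷ ws) (last<w ∷ _) (w<ws ∷ ws<) (w∈@(x , x≉0 , r) ∷ ws∈)
          -- `δ` is the number of values strictly between the previous weight `j + u` and the new
          -- weight `w`.
          with δ , refl ← m≤n⇒∃[o]m+o≡n last<w
          with steinitz-exchange es (map message xs) x (spanning x)
        -- The word adds nothing to the span: nothing is kept, and `weight-≤-totalWeight` preserves
        -- the bound of the last weight by the total.
        ... | inj₁ x∈xs = subst (λ l → l + h ≤ suc m) (sym (+-suc j (length ws)))
              (scan (suc j) (u + δ) es xs spanning len i≤
                (subst (_≤ m) assoc (InWS-≤ w∈))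
                (subst (_≤ totalWeight xs) assoc (weight-≤-totalWeight xs (word x _ r) x∈xs))
                (invariant-in-span (length xs) u δ (totalWeight xs) inv)
                ws (subst (λ l → All (l <_) ws) assoc w<ws) ws< ws∈)
          where
          assoc : suc (j + u) + δ ≡ suc j + (u + δ)
          assoc = cong suc (+-assoc j u δ)
        ... | inj₂ (es′ , es-len , es⊆) with m≤n⇒m<n∨m≡n i≤
        -- At most `t + 1` words are kept after adding this one, so the scan goes on with a larger
        -- total weight.
        ...   | inj₁ (s≤s i<) = subst (λ l → l + h ≤ suc m) (sym (+-suc j (length ws)))
              (scan (suc j) (u + δ) es′ (word x _ r ∷ xs) (λ y → es⊆ (spanning y))
                len′ (s≤s i<)
                (subst (_≤ m) assoc (InWS-≤ w∈))
                (≤-trans (≤-reflexive (sym assoc)) (m≤m+n _ _))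
                (invariant-off-span (length xs) j u δ (totalWeight xs) last≤S inv)
                ws (subst (λ l → All (l <_) ws) assoc w<ws) ws< ws∈)
          where
          assoc : suc (j + u) + δ ≡ suc j + (u + δ)
          assoc = cong suc (+-assoc j u δ)
          len′ : length es′ + suc (length xs) ≡ k
          len′ = trans (+-suc _ _) (trans (cong (_+ length xs) (sym es-len)) len)
        -- This is kept word number `t + 2`: `large` now forces enough skipped values, and the
        -- remaining weights are merely counted as distinct values up to `m`.
        ...   | inj₂ i≡ = subst (λ l → l + h ≤ suc m) (sym (+-suc j (length ws)))
              (bound-from-gaps (suc j) (u + δ) h (length ws)
                (gaps-from-sum (2 ^ suc t) h (totalWeight xs′) (u + δ)
                  (large es′ xs′ (λ y → es⊆ (spanning y)) len′ (cong suc i≡))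
                  (subst (λ i → 2 * suc (totalWeight xs′) ≤ 2 ^ suc i * (2 + (u + δ))) i≡
                    (invariant-off-span (length xs) j u δ (totalWeight xs) last≤S inv)))
                (subst (λ l → l + length ws ≤ m) assoc
                  (ascending-length _ ws (InWS-≤ w∈) w<ws ws< (All.map InWS-≤ ws∈))))
          where
          xs′ = word x _ r ∷ xs
          assoc : suc (j + u) + δ ≡ suc j + (u + δ)
          assoc = cong suc (+-assoc j u δ)
          len′ : length es′ + suc (length xs) ≡ k
          len′ = trans (+-suc _ _) (trans (cong (_+ length xs) (sym es-len)) len)

        ascending-weights-≤ : ∀ ws → AllPairs _<_ ws → All (InWS G) ws → length ws + h ≤ suc m
        ascending-weights-≤ ws ws< ws∈ =
          -- The scan starts from the standard basis with no word kept; the invariant reads `2 ≤ 2`.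
          scan 0 0 (tabulate unit) []
            (λ y → subst (λ es → KSpan es y) (sym (++-identityʳ (tabulate unit))) (KSpan-units y))
            (trans (+-identityʳ _) (length-tabulate unit)) z≤n z≤n z≤n ≤-refl ws (All.map InWS->0 ws∈) ws< ws∈

-- Sorting, parameter estimates and the final bound.

unique⇒ascending : ∀ {P : ℕ → Set} {ws} → Unique ws → All P ws →
  Σ (List ℕ) λ ws′ → length ws′ ≡ length ws × AllPairs _<_ ws′ × All P ws′
unique⇒ascending {ws = ws} unique Pws = sort ws , ↭-length (sort-↭ ws) ,
  AllPairs.zipWith (λ (w≤w′ , w≢w′) → ≤∧≢⇒< w≤w′ w≢w′)
    (Sorted⇒AllPairs ≤-totalOrder (sort-↗ ws) , Unique-resp-↭ (↭⇒↭ₛ (↭-sym (sort-↭ ws))) unique) ,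
  All-resp-↭ (↭-sym (sort-↭ ws)) Pws
  where
  open import Data.List.Relation.Binary.Permutation.Setoid.Properties (setoid ℕ) using (Unique-resp-↭)
  open import Data.List.Sort ≤-decTotalOrder using (sort; sort-↭; sort-↗)

primePower->1 : ∀ {q} → IsPrimePower q → 1 < q
primePower->1 (p , _ , p-prime , (e′ , refl) , refl) =
  ≤-trans (nonTrivial⇒n>1 p {{prime⇒nonTrivial p-prime}})
    (≤-trans (≤-reflexive (sym (*-identityʳ p))) (*-monoʳ-≤ p (m^n>0 p e′)))
  where instance p-nonZero = prime⇒nonZero p-prime

-- The floor gives `t * m ≤ k * m ∸ n`, hence `n ≤ (k ∸ t) * m`; removing `k ∸ t ∸ 2` blocks of size
-- `m` leaves at most two.
aParam-≤ : ∀ n m k → .{{_ : NonZero m}} → n ≤ k * m → aParam n m k ≤ 2 * m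
aParam-≤ n m k n≤km = m≤n+o⇒m∸n≤o n ((k ∸ t ∸ 2) * m) (begin
  n                            ≤⟨ m+n≤o⇒m≤o∸n n (≤-trans (+-monoʳ-≤ n (m/n*n≤m (k * m ∸ n) m)) (≤-reflexive (m+[n∸m]≡n n≤km))) ⟩
  k * m ∸ t * m                ≡⟨ *-distribʳ-∸ m k t ⟨
  (k ∸ t) * m                  ≤⟨ *-monoˡ-≤ m (m≤n+m∸n (k ∸ t) 2) ⟩
  (2 + (k ∸ t ∸ 2)) * m        ≡⟨ *-distribʳ-+ m 2 (k ∸ t ∸ 2) ⟩
  2 * m + (k ∸ t ∸ 2) * m      ≡⟨ +-comm (2 * m) _ ⟩
  (k ∸ t ∸ 2) * m + 2 * m      ∎)
  where
  open ≤-Reasoning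
  t = tParam n m k

theorem4p12 : (q n m k : ℕ) → .{{_ : NonZero m}} → IsPrimePower q →
    0 < n → 0 < k → m < n → n ≤ k * m →
    (E : FieldExt q m) →
    (G : RankMetric.Matrix E k n) →
    RankMetric.IsGenerator E G → RankMetric.Nondegenerate E G →
    RankMetric.WSCardLE E G ((m ∸ hParam n m k) + 1)
theorem4p12 q n m k qPrimePower _ _ _ n≤km E G _ nondegenerate ws unique ws∈
  with ws′ , len , ws′< , ws′∈ ← unique⇒ascending unique ws∈ = begin
    length ws               ≡⟨ len ⟨
    length ws′              ≤⟨ m+n≤o⇒m≤o∸n (length ws′) (combined ws′< ws′∈) ⟩
    suc m ∸ h               ≤⟨ suc-∸-≤ m h ⟩
    suc (m ∸ h)             ≡⟨ +-comm 1 (m ∸ h) ⟩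
    m ∸ h + 1               ∎
  where
  open ≤-Reasoning
  open LinearAlgebra E
  1<q = primePower->1 qPrimePower
  t = tParam n m k
  a = aParam n m k
  h = hParam n m k

  instance
    2^-nonZero : NonZero (2 ^ suc t)
    2^-nonZero = m^n≢0 2 (suc t)

  -- `h` is the maximum of `h₀` and 1. The scan handles `h₀`; for 1 it is enough that the weights
  -- are distinct and lie between 1 and `m`.
  h₀ = a / 2 ^ suc t

  suc-∸-≤ : ∀ m h → suc m ∸ h ≤ suc (m ∸ h)
  suc-∸-≤ m zero          = ≤-refl
  suc-∸-≤ zero (suc h)    = ≤-trans (≤-reflexive (0∸n≡0 h)) z≤n
  suc-∸-≤ (suc m) (suc h) = suc-∸-≤ m h

  h₀-≤-a : h₀ * 2 ^ suc t ≤ a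
  h₀-≤-a = m/n*n≤m a (2 ^ suc t)

  h₀-≤-m : h₀ * 2 ^ t ≤ m
  h₀-≤-m = *-cancelˡ-≤ 2 (begin
    2 * (h₀ * 2 ^ t)   ≡⟨ swap h₀ (2 ^ t) ⟩
    h₀ * 2 ^ suc t     ≤⟨ h₀-≤-a ⟩
    a                  ≤⟨ aParam-≤ n m k n≤km ⟩
    2 * m              ∎)
    where
    swap : ∀ h p → 2 * (h * p) ≡ h * (2 * p)
    swap = solve-∀

  a-≤-totalWeight : ∀ es xs → (∀ y → KSpan (es ++ map (message {1<q = 1<q} {G = G}) xs) y) →
    length es + length xs ≡ k → length xs ≡ 2 + t → a ≤ totalWeight 1<q G xs
  a-≤-totalWeight es xs spanning len i≡ = m≤n+o⇒m∸n≤o n ((k ∸ t ∸ 2) * m)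
    (subst (λ l → n ≤ l * m + totalWeight 1<q G xs) es-length (nondegenerate-≤ 1<q G nondegenerate es xs spanning))
    where
    -- With `t + 2` words kept, `k ∸ t ∸ 2` vectors remain, which is the multiple of `m` subtracted
    -- from `n` in `a`.
    es-length : length es ≡ k ∸ t ∸ 2
    es-length = begin-equality
      length es                            ≡⟨ m+n∸n≡m (length es) (t + 2) ⟨
      length es + (t + 2) ∸ (t + 2)        ≡⟨ cong (λ l → length es + l ∸ (t + 2)) (trans (+-comm t 2) (sym i≡)) ⟩
      length es + length xs ∸ (t + 2)      ≡⟨ cong (_∸ (t + 2)) len ⟩
      k ∸ (t + 2)                          ≡⟨ ∸-+-assoc k t 2 ⟨
      k ∸ t ∸ 2                            ∎

  combined : ∀ {ws′} → AllPairs _<_ ws′ → All (RankMetric.InWS E G) ws′ → length ws′ + h ≤ suc m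
  combined {ws′} ws′< ws′∈ = begin
    length ws′ + h                               ≡⟨ +-distribˡ-⊔ (length ws′) h₀ 1 ⟩
    (length ws′ + h₀) ⊔ (length ws′ + 1)         ≤⟨ ⊔-lub
      (ascending-weights-≤ 1<q G t h₀ h₀-≤-m
        (λ es xs spanning len i≡ → ≤-trans h₀-≤-a (a-≤-totalWeight es xs spanning len i≡)) ws′ ws′< ws′∈)
      (≤-trans (≤-reflexive (+-comm (length ws′) 1)) (s≤s
        (WeightArithmetic.ascending-length 0 ws′ z≤n (All.map (InWS->0 1<q G) ws′∈) ws′< (All.map (InWS-≤ 1<q G) ws′∈)))) ⟩
    suc m                                        ∎
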